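{- Let $(Co_{\mathbf{K}},i)$ be an equational filter pair over $\Sigma$, with associated logic $l=(\Sigma,\vdash^X)$. If for every $\Sigma$-structure $A$ the map $i_A$ is surjective onto the collection of $l$-filters of $A$, then $l$ is truth-equational.
   Context: $Fm(X)$ is the absolutely free $\Sigma$-structure on a set $X$ of variables. A quasivariety is a class of $\Sigma$-structures axiomatizable by quasi-identities. $Co_{\mathbf{K}}(A)$ is the lattice of congruences $\theta$ on $A$ with $A/\theta\in\mathbf{K}$, ordered by inclusion. An equational filter pair is a pair $(Co_{\mathbf{K}},i)$ with $\mathbf{K}$ a quasivariety and $i_A:Co_{\mathbf{K}}(A)\to\mathcal{P}(A)$, $i_A(\theta)=\{a\in A\mid\langle\delta^A(a),\epsilon^A(a)\rangle\in\theta$ for all $\delta\approx\epsilon\in\tau\}$ for every $\Sigma$-structure $A$, where $\tau$ is a fixed finite set of equations in at most one variable. The associated logic $(\Sigma,\vdash^X)$: $\Gamma\vdash^X\varphi$ iff for all $\theta\in Co_{\mathbf{K}}(Fm(X))$, $\Gamma\subseteq i_{Fm(X)}(\theta)$ implies $\varphi\in i_{Fm(X)}(\theta)$. An $l$-filter on $A$ is a subset $F\subseteq A$ such that whenever $\Gamma\vdash^X\varphi$ and $v:Fm(X)\to A$ is a homomorphism with $v[\Gamma]\subseteq F$, then $v(\varphi)\in F$. An $l$-matrix is a pair $\langle A,F\rangle$ with $F$ an $l$-filter on $A$. A congruence $\theta$ on $A$ is compatible with $F\subseteq A$ if $a\in F$ and $\langle a,b\rangle\in\theta$ imply $b\in F$;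 $\Omega^A(F)$ is the largest congruence compatible with $F$. An $l$-matrix $\langle A,F\rangle$ is reduced if $\Omega^A(F)$ is the equality relation on $A$. A logic $l$ is truth-equational if there is a set $\tau'(p)$ of equations in one variable $p$ such that for every reduced $l$-matrix $\langle A,F\rangle$ and every $a\in A$: $a\in F$ iff $\delta^A(a)=\epsilon^A(a)$ for every $\delta\approx\epsilon\in\tau'(p)$. -}

module Defs where

open import Data.List using (List)
open import Data.List.Relation.Unary.All as All using (All)
open import Data.Nat using (ℕ)
open import Data.Product using (Σ-syntax; ∃; _×_; _,_)
open import Data.Unit using (⊤)
open import Data.Vec using (Vec; []; _∷_; map)
open import Data.Vec.Relation.Binary.Pointwise.Inductive as PW using (Pointwise; []; _∷_)
open import Function using (const)
open import Function.Bundles using (_⇔_)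
open import Level using (Level; suc; _⊔_)
open import Relation.Binary using (Rel; Setoid; IsEquivalence; _⇒_; _Respects_)
open import Relation.Binary.PropositionalEquality as ≡ using (_≡_)
open import Relation.Unary using (Pred; _∈_; _⊆_; _≐_)

-- Op n is the set of n-ary operation symbols (connectives).
Signature : ∀ ℓ → Set (suc ℓ)
Signature ℓ = ℕ → Set ℓ

private variable
  ℓ v : Level

-- Carriers are setoids, with the setoid equality in the role of equality of
-- elements: quotients can then be formed without quotient types.
record Structure (Op : Signature ℓ) : Set (suc ℓ) where
  field
    setoid : Setoid ℓ ℓ
  open Setoid setoid public
  field
    ⟦_⟧     : ∀ {n} → Op n → Vec Carrier n → Carrier
    ⟦⟧-cong : ∀ {n} (f : Op n) {xs ys : Vec Carrier n} →
              Pointwise _≈_ xs ys → ⟦ f ⟧ xs ≈ ⟦ f ⟧ ys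

open Structure using (Carrier)

record Homomorphism {Op : Signature ℓ} (A B : Structure Op) : Set ℓ where
  private
    module A = Structure A
    module B = Structure B
  field
    to   : A.Carrier → B.Carrier
    cong : ∀ {a b} → a A.≈ b → to a B.≈ to b
    homo : ∀ {n} (f : Op n) (as : Vec A.Carrier n) →
           to (A.⟦ f ⟧ as) B.≈ B.⟦ f ⟧ (map to as)

-- Subsets of a setoid are predicates invariant under its equality.
record 𝒫 {Op : Signature ℓ} (A : Structure Op) : Set (suc ℓ) where
  open Structure A using (_≈_)
  field
    mem  : Pred (Carrier A) ℓ
    resp : mem Respects _≈_

open 𝒫 public using (mem)

-- The field `reflexive` is reflexivity over the setoid equality.
record Congruence {Op : Signature ℓ} (A : Structure Op) : Set (suc ℓ) where
  open Structure A using (_≈_; ⟦_⟧)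
  field
    rel           : Rel (Carrier A) ℓ
    isEquivalence : IsEquivalence rel
    reflexive     : _≈_ ⇒ rel
    ⟦⟧-cong       : ∀ {n} (f : Op n) {xs ys : Vec (Carrier A) n} →
                    Pointwise rel xs ys → rel (⟦ f ⟧ xs) (⟦ f ⟧ ys)

open Congruence public using (rel)

Δ : {Op : Signature ℓ} (A : Structure Op) → Congruence A
Δ A = record
  { rel           = A._≈_
  ; isEquivalence = A.isEquivalence
  ; reflexive     = λ a≈b → a≈b
  ; ⟦⟧-cong       = A.⟦⟧-cong
  } where module A = Structure A

infixl 7 _/_

_/_ : {Op : Signature ℓ} (A : Structure Op) → Congruence A → Structure Op
A / θ = record
  { setoid  = record { isEquivalence = θ.isEquivalence }
  ; ⟦_⟧     = Structure.⟦_⟧ A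
  ; ⟦⟧-cong = θ.⟦⟧-cong
  } where module θ = Congruence θ

data Term (Op : Signature ℓ) (V : Set v) : Set (ℓ ⊔ v) where
  var : V → Term Op V
  op  : ∀ {n} → Op n → Vec (Term Op V) n → Term Op V

Fm : (Op : Signature ℓ) → Set ℓ → Structure Op
Fm Op X = record
  { setoid  = ≡.setoid (Term Op X)
  ; ⟦_⟧     = op
  ; ⟦⟧-cong = λ f ts≡us → ≡.cong (op f) (PW.Pointwise-≡⇒≡ ts≡us)
  }

module _ {Op : Signature ℓ} (A : Structure Op) {V : Set v} where
  open Structure A using (_≈_; ⟦_⟧; ⟦⟧-cong)

  eval  : (V → Carrier A) → Term Op V → Carrier A
  evals : ∀ {n} → (V → Carrier A) → Vec (Term Op V) n → Vec (Carrier A) n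
  eval  ρ (var x)   = ρ x
  eval  ρ (op f ts) = ⟦ f ⟧ (evals ρ ts)
  evals ρ []        = []
  evals ρ (t ∷ ts)  = eval ρ t ∷ evals ρ ts

  eval-cong  : ∀ {ρ σ} → (∀ x → ρ x ≈ σ x) → ∀ t → eval ρ t ≈ eval σ t
  evals-cong : ∀ {n ρ σ} → (∀ x → ρ x ≈ σ x) → (ts : Vec (Term Op V) n) →
               Pointwise _≈_ (evals ρ ts) (evals σ ts)
  eval-cong  ρ≈σ (var x)   = ρ≈σ x
  eval-cong  ρ≈σ (op f ts) = ⟦⟧-cong f (evals-cong ρ≈σ ts)
  evals-cong ρ≈σ []        = []
  evals-cong ρ≈σ (t ∷ ts)  = eval-cong ρ≈σ t ∷ evals-cong ρ≈σ ts

infix 4 _≈̇_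

record Equation (Op : Signature ℓ) (V : Set v) : Set (ℓ ⊔ v) where
  constructor _≈̇_
  field
    lhs rhs : Term Op V

-- The value t^A(a) of a term in at most one variable.
_^_at_ : {Op : Signature ℓ} → Term Op ⊤ → (A : Structure Op) → Carrier A → Carrier A
t ^ A at a = eval A (const a) t

record QuasiIdentity (Op : Signature ℓ) : Set ℓ where
  constructor _⟹_
  field
    premises   : List (Equation Op ℕ)
    conclusion : Equation Op ℕ

module _ {Op : Signature ℓ} (A : Structure Op) where
  open Structure A using (_≈_)

  Holds : (ℕ → Carrier A) → Equation Op ℕ → Set ℓ
  Holds ρ (s ≈̇ t) = eval A ρ s ≈ eval A ρ t

  _⊨_ : QuasiIdentity Op → Set ℓ
  _⊨_ (ps ⟹ e) = ∀ ρ → All (Holds ρ) ps → Holds ρ e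

IsQuasivariety : {Op : Signature ℓ} → Pred (Structure Op) ℓ → Set (suc ℓ)
IsQuasivariety {ℓ} {Op} K =
  Σ[ Q ∈ Pred (QuasiIdentity Op) ℓ ] (∀ A → A ∈ K ⇔ (∀ q → q ∈ Q → A ⊨ q))

Co : {Op : Signature ℓ} → Pred (Structure Op) ℓ → Structure Op → Set (suc ℓ)
Co K A = Σ[ θ ∈ Congruence A ] A / θ ∈ K

-- Only the consequence relation matters below, so l-filters and
-- truth-equationality are defined for an arbitrary relation between sets of
-- formulas and formulas.
Consequence : (Op : Signature ℓ) → Set ℓ → Set (suc (suc ℓ))
Consequence {ℓ} Op X = 𝒫 (Fm Op X) → Term Op X → Set (suc ℓ)

module _ {Op : Signature ℓ} where

  IsFilter : {X : Set ℓ} → Consequence Op X → (A : Structure Op) → 𝒫 A → Set (suc ℓ)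
  IsFilter {X} _⊢_ A F =
    ∀ Γ φ → Γ ⊢ φ → (h : Homomorphism (Fm Op X) A) →
    let open Homomorphism h in
    (∀ {ψ} → ψ ∈ mem Γ → to ψ ∈ mem F) → to φ ∈ mem F

  Compatible : (A : Structure Op) → Congruence A → 𝒫 A → Set ℓ
  Compatible A θ F = ∀ {a b} → a ∈ mem F → rel θ a b → b ∈ mem F

  -- Ω is the Leibniz congruence Ω^A(F): the largest congruence compatible
  -- with F.
  IsLeibniz : (A : Structure Op) → 𝒫 A → Congruence A → Set (suc ℓ)
  IsLeibniz A F Ω =
    Compatible A Ω F × (∀ θ → Compatible A θ F → ∀ {a b} → rel θ a b → rel Ω a b)

  IsReduced : (A : Structure Op) → 𝒫 A → Set (suc ℓ)
  IsReduced A F = IsLeibniz A F (Δ A)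

  TruthEquational : {X : Set ℓ} → Consequence Op X → Set (suc ℓ)
  TruthEquational l =
    Σ[ τ′ ∈ Pred (Equation Op ⊤) ℓ ]
      (∀ A F → IsFilter l A F → IsReduced A F →
       let open Structure A using (_≈_) in
       ∀ a → a ∈ mem F ⇔ (∀ δ ε → (δ ≈̇ ε) ∈ τ′ → δ ^ A at a ≈ ε ^ A at a))

-- The map i is determined by K and τ.  Terms over ⊤ are the terms in at most
-- one variable.
record EquationalFilterPair (Op : Signature ℓ) : Set (suc (suc ℓ)) where
  field
    K              : Pred (Structure Op) ℓ
    isQuasivariety : IsQuasivariety K
    τ              : List (Equation Op ⊤)

  i : (A : Structure Op) → Co K A → 𝒫 A
  i A (θ , _) = record
    { mem  = λ a → All (λ (δ ≈̇ ε) → rel θ (δ ^ A at a) (ε ^ A at a)) τ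
    ; resp = λ a≈b → All.map λ { {δ ≈̇ ε} δaθεa →
        trans (reflexive (eval-cong A (λ _ → A.sym a≈b) δ))
          (trans δaθεa (reflexive (eval-cong A (λ _ → a≈b) ε))) }
    }
    where
    module A = Structure A
    open Congruence θ using (isEquivalence; reflexive)
    open IsEquivalence isEquivalence using (trans)

  associatedLogic : (X : Set ℓ) → Consequence Op X
  associatedLogic X Γ φ =
    ∀ θ → mem Γ ⊆ mem (i (Fm Op X) θ) → φ ∈ mem (i (Fm Op X) θ)

  -- That each i_A(θ) is itself an l-filter holds for every filter pair, so it
  -- is not demanded again.
  SurjectiveOntoFilters : Set ℓ → Structure Op → Set (suc ℓ)
  SurjectiveOntoFilters X A =
    ∀ F → IsFilter (associatedLogic X) A F → ∃ λ θ → mem (i A θ) ≐ mem F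

{-# OPTIONS --safe #-}
-- If F = i_A(θ), then θ is compatible with F, because θ-related elements give
-- θ-related values of every term.  When ⟨A, F⟩ is reduced, θ is therefore the
-- equality of A, and F is the solution set of τ itself.
module Submission where

open import Defs
open import Data.List.Membership.Propositional using () renaming (_∈_ to _∈ˡ_)
import Data.List.Relation.Unary.All as All
open import Data.Product using (_,_; proj₁)
open import Data.Vec using (Vec; []; _∷_)
open import Data.Vec.Relation.Binary.Pointwise.Inductive using (Pointwise; []; _∷_)
open import Function.Bundles using (mk⇔)
open import Level using (Level)
open import Relation.Binary using (IsEquivalence)

private variable
  ℓ v : Level

module _ {Op : Signature ℓ} {A : Structure Op} (θ : Congruence A) {V : Set v} where
  open Structure A using (Carrier)

  -- Terms are evaluated in `A` here. Evaluation in `A / θ` agrees with this only after an induction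
  -- on the term, so `eval-cong` for the quotient does not give it at once.
  eval-rel  : {ρ σ : V → Carrier} → (∀ x → rel θ (ρ x) (σ x)) →
              ∀ t → rel θ (eval A ρ t) (eval A σ t)
  evals-rel : ∀ {n} {ρ σ : V → Carrier} → (∀ x → rel θ (ρ x) (σ x)) →
              (ts : Vec (Term Op V) n) → Pointwise (rel θ) (evals A ρ ts) (evals A σ ts)
  eval-rel  ρθσ (var x)   = ρθσ x
  eval-rel  ρθσ (op f ts) = Congruence.⟦⟧-cong θ f (evals-rel ρθσ ts)
  evals-rel ρθσ []        = []
  evals-rel ρθσ (t ∷ ts)  = eval-rel ρθσ t ∷ evals-rel ρθσ ts

module _ {Op : Signature ℓ} (P : EquationalFilterPair Op) where
  open EquationalFilterPair P

  -- For `a` in the set and `b` related to `a`, the chain δ(b) θ δ(a) θ ε(a) θ ε(b) puts `b` in it.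
  i-compatible : (A : Structure Op) (θ : Co K A) → Compatible A (proj₁ θ) (i A θ)
  i-compatible A (θ , _) a∈i aθb = All.map
    (λ { {δ ≈̇ ε} δaθεa →
      trans (eval-rel θ (λ _ → sym aθb) δ) (trans δaθεa (eval-rel θ (λ _ → aθb) ε)) })
    a∈i
    where open IsEquivalence (Congruence.isEquivalence θ) using (sym; trans)

proposition3p13 : ∀ {ℓ} (Op : Signature ℓ) (X : Set ℓ) (P : EquationalFilterPair Op) →
    (∀ A → EquationalFilterPair.SurjectiveOntoFilters P X A) →
    TruthEquational (EquationalFilterPair.associatedLogic P X)
proposition3p13 Op X P surjective = (_∈ˡ τ) , λ A F isFilter (_ , greatest) a →
  let (θ , θ∈K) , i⊆F , F⊆i = surjective A F isFilter
      compatible : Compatible A θ F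
      compatible = λ a∈F aθb → i⊆F (i-compatible P A (θ , θ∈K) (F⊆i a∈F) aθb)
  in mk⇔
    -- Reducedness makes `Δ A` the Leibniz congruence, so `greatest` turns the θ-relation of both
    -- sides into equality in `A`.
    (λ a∈F _ _ e∈τ → greatest θ compatible (All.lookup (F⊆i a∈F) e∈τ))
    -- Conversely, equality in `A` lies inside θ.
    (λ solves → i⊆F (All.tabulate λ e∈τ → Congruence.reflexive θ (solves _ _ e∈τ)))
  where open EquationalFilterPair P using (τ)
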